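{- The minimum size of advice permitting the agent to explore every $n$-node graph in time polynomial in $n$ is $\log\log\log n-\Theta(1)$, both for instance oracles and for map oracles. Precisely: (i) for every constant $c>0$ there are a map oracle with advice size at most $\lfloor\log\log\log n-c\rfloor$ and a deterministic algorithm exploring every $n$-node graph from every starting node in time polynomial in $n$; (ii) for every function $\phi:\mathbb{N}\to\mathbb{N}$ with $\phi(n)\to\infty$, no instance oracle (hence no map oracle) with advice size at most $\log\log\log n-\phi(n)$, together with any deterministic algorithm, explores all $n$-node graphs in time polynomial in $n$.
   Context: Model: a graph is a simple connected undirected graph with $n$ nodes. Nodes are unlabeled; at each node of degree $d$ the incident edges carry distinct port numbers $0,\dots,d-1$, arbitrarily assigned. A mobile agent starts at some node. At each step, located at a node $u$ whose degree it knows, it chooses a port at $u$ and traverses the corresponding edge to a neighbor $w$; upon arrival it learns the port number of this edge at $w$ and the degree of $w$. The agent must visit all nodes and stop; the time of exploration is the number of edge traversals. A deterministic exploration algorithm receives as input a binary string (advice); the size of advice is its length. A map oracle is a function $f$ assigning a binary string $f(G)$ to each port-numbered graph $G$; an instance oracle assigns a binary string $f(G,v)$ to each pair $(G,v)$ with $v$ the starting node. Logarithms are to base 2. -}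

module Defs where

open import Data.Bool.Base using (Bool)
open import Data.Fin.Base using (Fin; cast)
open import Data.Fin.Permutation using (Permutation′; _⟨$⟩ʳ_)
open import Data.List.Base using (List; []; _∷_; length)
open import Data.List.Membership.Propositional using (_∈_)
open import Data.Maybe.Base using (Maybe; just; nothing)
open import Data.Nat.Base using (ℕ; _≤_; _*_; _^_; _∸_)
open import Data.Nat.Logarithm using (⌊log₂_⌋)
open import Data.Product.Base using (Σ; ∃; ∃-syntax; ∃₂; _×_; _,_; proj₁; proj₂)
open import Relation.Binary.Construct.Closure.ReflexiveTransitive using (Star)
open import Relation.Binary.PropositionalEquality using (_≡_; _≢_)

-- Simple connected undirected graphs with n nodes and port numbers.
-- rot (u , p) ≡ (w , q) means that the edge with port p at u leads to w, where
-- it has port q; that the graph is undirected is the involutivity of rot.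
record PortGraph (n : ℕ) : Set where
  field
    deg : Fin n → ℕ

  Port : Set
  Port = Σ (Fin n) (λ u → Fin (deg u))

  field
    rot : Port → Port

  neighbour : (u : Fin n) → Fin (deg u) → Fin n
  neighbour u p = proj₁ (rot (u , p))

  Adjacent : Fin n → Fin n → Set
  Adjacent u w = ∃[ p ] neighbour u p ≡ w

  field
    rot-involutive   : ∀ x → rot (rot x) ≡ x
    no-loops         : ∀ u p → neighbour u p ≢ u
    no-multiple-edge : ∀ u p q → neighbour u p ≡ neighbour u q → p ≡ q
    connected        : ∀ u w → Star Adjacent u w

open PortGraph

record _≅_ {n : ℕ} (G H : PortGraph n) : Set where
  field
    nodes      : Permutation′ n
    deg-pres   : ∀ u → deg G u ≡ deg H (nodes ⟨$⟩ʳ u)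

  onPorts : Port G → Port H
  onPorts (u , p) = nodes ⟨$⟩ʳ u , cast (deg-pres u) p

  field
    rot-pres   : ∀ x → rot H (onPorts x) ≡ onPorts (rot G x)

Advice : Set
Advice = List Bool

MapOracle : Set
MapOracle = ∀ {n} → PortGraph n → Advice

InstanceOracle : Set
InstanceOracle = ∀ {n} → PortGraph n → Fin n → Advice

-- Nodes are unlabelled: the advice does not depend on how they are named by
-- elements of Fin n.
LabelIndependent : MapOracle → Set
LabelIndependent f = ∀ {n} (G H : PortGraph n) → G ≅ H → f G ≡ f H

toInstance : MapOracle → InstanceOracle
toInstance f G _ = f G

-- What the agent has observed so far; the index is the degree of the current
-- node.  In  move h p d q  the agent left by port p and arrived by port q at a
-- node of degree d.
data History : ℕ → Set where
  start : ∀ d → History d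
  move  : ∀ {d} → History d → Fin d → ∀ d′ → Fin d′ → History d′

-- nothing: stop;  just p: leave by port p.
Algorithm : Set
Algorithm = Advice → ∀ {d} → History d → Maybe (Fin d)

-- Execution A s G u h ws: being at u with history h and advice s, the agent
-- makes exactly length ws further edge traversals, which lead successively to
-- the nodes ws, and then stops.
data Execution (A : Algorithm) (s : Advice) {n : ℕ} (G : PortGraph n) :
               (u : Fin n) → History (deg G u) → List (Fin n) → Set where
  stop : ∀ {u h} → A s h ≡ nothing → Execution A s G u h []
  step : ∀ {u h p w q ws} → A s h ≡ just p → rot G (u , p) ≡ (w , q) →
         Execution A s G w (move h p (deg G w) q) ws →
         Execution A s G u h (w ∷ ws)

ExploresWithin : Algorithm → Advice → ∀ {n} → PortGraph n → Fin n → ℕ → Set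
ExploresWithin A s G v t =
  ∃[ ws ] Execution A s G v (start (deg G v)) ws
        × (∀ u → u ∈ v ∷ ws)
        × length ws ≤ t

ExploresInPolyTime : Algorithm → InstanceOracle → Set
ExploresInPolyTime A f =
  ∃₂ λ a k → ∀ {n} (G : PortGraph n) v → ExploresWithin A (f G v) G v (a * n ^ k)

-- For n ≥ 4 and c : ℕ, ⌊ log log log n - c ⌋ when that is nonnegative, since
-- ⌊ log ⌊ x ⌋ ⌋ = ⌊ log x ⌋ for x ≥ 1; otherwise (and for n < 4) it is 0, a
-- length of advice being nonnegative.  A natural c loses no generality: the
-- bound decreases with c, so a real constant can be replaced by its ceiling.
logloglog_-_ : ℕ → ℕ → ℕ
logloglog n - c = ⌊log₂ ⌊log₂ ⌊log₂ n ⌋ ⌋ ⌋ ∸ c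

AdviceSizeAtMost : InstanceOracle → (ℕ → ℕ) → Set
AdviceSizeAtMost f b = ∀ {n} (G : PortGraph n) v → length (f G v) ≤ b n

TendsToInfinity : (ℕ → ℕ) → Set
TendsToInfinity φ = ∀ M → ∃[ N ] ∀ n → N ≤ n → M ≤ φ n

{-# OPTIONS --safe #-}
module Submission where

-- Upper bound.  Let the agent obey a fixed sequence of instructions x < N,
-- where x means "take port x, if there is one".  For a random sequence this is
-- a walk with uniform stationary distribution, so for every node t the
-- probabilities of not returning to t within k steps, summed over k < T, are at
-- most n; hence a walk from a neighbour of t misses t for T steps with
-- probability at most n N / T.  Following a simple path, every walk hits every
-- node within O(N^4) steps with probability 1/2, so some sequence of length
-- O(N^7) is good for all graphs of size at most N.  Advice of length
-- logloglog n - c determines loglog n up to an additive constant, and with it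
-- an N that is at least n and polynomial in n.
--
-- Lower bound.  In rings with ports 0, 1 in clockwise order all nodes look the
-- same, so that the advice alone determines the number of steps.  Rings whose
-- sizes are not polynomially related therefore need distinct advice.

open import Data.Bool.Base using (true; false)
open import Data.Fin.Base using (Fin; zero; suc; toℕ; fromℕ; fromℕ<; inject₁; inject≤; combine; remQuot; funToFin; finToFun)
open import Data.Fin.Induction using (<-weakInduction)
import Data.Fin.Properties as Fin
open import Data.Fin.Relation.Unary.Top using (view; view-fromℕ; view-inject₁; ‵fromℕ; ‵inject₁)
open import Data.List.Base using (List; []; _∷_; length; foldl)
open import Data.List.Membership.Propositional using (_∈_)
import Data.List.Membership.Setoid.Properties as Membership
open import Data.List.Relation.Unary.Any using (here; there; index)
open import Data.Maybe.Base as Maybe using (Maybe; just; nothing)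
open import Data.Maybe.Properties using (just-injective)
open import Data.Nat.Base
open import Data.Nat.DivMod using (_/_; _%_; m≡m%n+[m/n]*n; m%n<n; m/n*n≤m)
open import Data.Nat.Induction using (<-rec)
open import Data.Nat.Logarithm
open import Data.Nat.Properties
open import Data.Nat.Tactic.RingSolver using (solve-∀)
open import Algebra.Properties.CommutativeMonoid.Sum +-0-commutativeMonoid
  using (sum; sum-cong-≗; ∑-distrib-+; ∑-comm; sum-replicate-zero)
open import Algebra.Properties.Semiring.Sum +-*-semiring using (*-distribˡ-sum; *-distribʳ-sum)
open import Data.Product.Base
open import Function.Base using (_∘_; it)
open import Function.Definitions using (Injective)
open import Relation.Binary.Construct.Closure.ReflexiveTransitive using (Star; ε; _◅_; _◅◅_)
open import Relation.Binary.PropositionalEquality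
open import Relation.Nullary using (¬_; Dec; yes; no; contradiction)
open import Defs
open PortGraph

open ≤-Reasoning hiding (start; stop)
private module ≡ = ≡-Reasoning

-- Powers and logarithms

*-swap : ∀ a b c → a * (b * c) ≡ b * (a * c)
*-swap = solve-∀

^-distribʳ-* : ∀ m n k → (m * n) ^ k ≡ m ^ k * n ^ k
^-distribʳ-* m n zero    = refl
^-distribʳ-* m n (suc k) = trans (cong (m * n *_) (^-distribʳ-* m n k)) (interchange m n (m ^ k) (n ^ k))
  where
  interchange : ∀ a b c d → a * b * (c * d) ≡ a * c * (b * d)
  interchange = solve-∀

n<2^n : ∀ n → n < 2 ^ n
n<2^n zero    = s≤s z≤n
n<2^n (suc n) = begin
  suc (suc n)    ≤⟨ s≤s (m≤n+m (suc n) n) ⟩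
  suc n + suc n  ≤⟨ +-mono-≤ (n<2^n n) (n<2^n n) ⟩
  2 ^ n + 2 ^ n  ≡⟨ cong (2 ^ n +_) (+-identityʳ (2 ^ n)) ⟨
  2 ^ suc n      ∎

⌊log₂⌋-upper : ∀ n → n < 2 ^ suc ⌊log₂ n ⌋
⌊log₂⌋-upper n = ≰⇒> λ 2^≤n → 1+n≰n
  (≤-trans (≤-reflexive (sym (⌊log₂[2^n]⌋≡n (suc ⌊log₂ n ⌋)))) (⌊log₂⌋-mono-≤ 2^≤n))

<2^⇒⌊log₂⌋≤ : ∀ k {n} → n < 2 ^ suc k → ⌊log₂ n ⌋ ≤ k
<2^⇒⌊log₂⌋≤ zero    {n} n<2 = ⌊log₂⌋-mono-≤ (s≤s⁻¹ n<2)
<2^⇒⌊log₂⌋≤ (suc k) {n} n<2^ = begin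
  ⌊log₂ n ⌋              ≤⟨ m≤n+m∸n ⌊log₂ n ⌋ 1 ⟩
  suc (⌊log₂ n ⌋ ∸ 1)    ≡⟨ cong suc (⌊log₂⌊n/2⌋⌋≡⌊log₂n⌋∸1 n) ⟨
  suc ⌊log₂ ⌊ n /2⌋ ⌋    ≤⟨ s≤s (<2^⇒⌊log₂⌋≤ k half<) ⟩
  suc k                  ∎
  where
  half< : ⌊ n /2⌋ < 2 ^ suc k
  half< = *-cancelˡ-< 2 _ _ (begin-strict
    2 * ⌊ n /2⌋              ≡⟨ cong (⌊ n /2⌋ +_) (+-identityʳ ⌊ n /2⌋) ⟩
    ⌊ n /2⌋ + ⌊ n /2⌋        ≤⟨ +-monoʳ-≤ ⌊ n /2⌋ (⌊n/2⌋≤⌈n/2⌉ n) ⟩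
    ⌊ n /2⌋ + ⌈ n /2⌉        ≡⟨ ⌊n/2⌋+⌈n/2⌉≡n n ⟩
    n                        <⟨ n<2^ ⟩
    2 ^ suc (suc k)          ∎)

⌊log₂⌋-lower : ∀ n .{{_ : NonZero n}} → 2 ^ ⌊log₂ n ⌋ ≤ n
⌊log₂⌋-lower n with ⌊log₂ n ⌋ in eq
... | zero  = >-nonZero⁻¹ n
... | suc k = ≮⇒≥ λ n<2^ → 1+n≰n (≤-trans (≤-reflexive (sym eq)) (<2^⇒⌊log₂⌋≤ k n<2^))

-- Advice as numbers

-- The number with bijective binary representation s, least significant digit
-- first, where false and true stand for the digits 1 and 2.
value : Advice → ℕ
value []          = 0
value (false ∷ s) = suc (2 * value s)
value (true  ∷ s) = 2 * suc (value s)

value-injective : ∀ s t → value s ≡ value t → s ≡ t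
value-injective []          []          _  = refl
value-injective []          (false ∷ _) ()
value-injective []          (true ∷ _)  ()
value-injective (false ∷ s) (false ∷ t) eq =
  cong (false ∷_) (value-injective s t (*-cancelˡ-≡ _ _ 2 (suc-injective eq)))
value-injective (true ∷ s)  (true ∷ t)  eq =
  cong (true ∷_) (value-injective s t (suc-injective (*-cancelˡ-≡ (suc (value s)) (suc (value t)) 2 eq)))
value-injective (false ∷ s) (true ∷ t)  eq = contradiction (sym eq) (even≢odd (suc (value t)) (value s))
value-injective (true ∷ s)  (false ∷ t) eq = contradiction eq (even≢odd (suc (value s)) (value t))

-- `suc (value s)` is the ordinary binary number with the digits of `s` (`false` as 0, `true` as 1)
-- below a leading 1. Its `suc (length s)` digits give this bound and `value-lower`.
value-upper : ∀ s → suc (value s) < 2 ^ suc (length s)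
value-upper []          = s≤s (s≤s z≤n)
value-upper (false ∷ s) = begin-strict
  2 + 2 * value s     ≡⟨ *-suc 2 (value s) ⟨
  2 * suc (value s)   <⟨ *-monoʳ-< 2 (value-upper s) ⟩
  2 ^ (2 + length s)  ∎
value-upper (true ∷ s)  = begin
  2 + 2 * suc (value s)    ≡⟨ *-suc 2 (suc (value s)) ⟨
  2 * suc (suc (value s))  ≤⟨ *-monoʳ-≤ 2 (value-upper s) ⟩
  2 ^ (2 + length s)       ∎

value-lower : ∀ s → 2 ^ length s ≤ suc (value s)
value-lower []          = s≤s z≤n
value-lower (false ∷ s) = ≤-trans (*-monoʳ-≤ 2 (value-lower s)) (≤-reflexive (*-suc 2 (value s)))
value-lower (true ∷ s)  = ≤-trans (*-monoʳ-≤ 2 (value-lower s)) (n≤1+n _)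

increment : Advice → Advice
increment []          = false ∷ []
increment (false ∷ s) = true ∷ s
increment (true ∷ s)  = false ∷ increment s

value-increment : ∀ s → value (increment s) ≡ suc (value s)
value-increment []          = refl
value-increment (false ∷ s) = *-suc 2 (value s)
value-increment (true ∷ s)  = cong (λ v → suc (2 * v)) (value-increment s)

encode : ℕ → Advice
encode zero    = []
encode (suc n) = increment (encode n)

value-encode : ∀ n → value (encode n) ≡ n
value-encode zero    = refl
value-encode (suc n) = trans (value-increment (encode n)) (cong suc (value-encode n))

-- Sums

sum-mono : ∀ {n} {f g : Fin n → ℕ} → (∀ i → f i ≤ g i) → sum f ≤ sum g
sum-mono {zero}  f≤g = z≤n
sum-mono {suc n} f≤g = +-mono-≤ (f≤g zero) (sum-mono (f≤g ∘ suc))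

term≤sum : ∀ {n} (f : Fin n → ℕ) i → f i ≤ sum f
term≤sum f zero    = m≤m+n _ _
term≤sum f (suc i) = ≤-trans (term≤sum (f ∘ suc) i) (m≤n+m _ _)

term≡0 : ∀ {n} (f : Fin n → ℕ) → sum f ≡ 0 → ∀ i → f i ≡ 0
term≡0 f eq i = n≤0⇒n≡0 (≤-trans (term≤sum f i) (≤-reflexive eq))

sum-const : ∀ n c → sum {n} (λ _ → c) ≡ n * c
sum-const zero    c = refl
sum-const (suc n) c = cong (c +_) (sum-const n c)

below-average : ∀ {n} .{{_ : NonZero n}} (f : Fin n → ℕ) → ∃ λ i → n * f i ≤ sum f
below-average {1} f = zero , ≤-refl
below-average {2+ n} f with below-average (f ∘ suc)
... | i , avg with f (suc i) ≤? f zero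
...   | yes fi≤f0 = suc i , +-mono-≤ fi≤f0 avg
...   | no  fi≰f0 = zero , +-monoʳ-≤ (f zero) (≤-trans (*-monoʳ-≤ (suc n) (≰⇒≥ fi≰f0)) avg)

𝟙 : ∀ {P : Set} → Dec P → ℕ
𝟙 (yes _) = 1
𝟙 (no _)  = 0

sum-𝟙 : ∀ {n} (w : Fin n) (f : Fin n → ℕ) → sum (λ u → 𝟙 (w Fin.≟ u) * f u) ≡ f w
sum-𝟙 {suc n} zero f = ≡.begin
  f zero + 0 + sum {n} (λ _ → 0)  ≡.≡⟨ cong₂ _+_ (+-identityʳ (f zero)) (sum-replicate-zero n) ⟩
  f zero + 0                      ≡.≡⟨ +-identityʳ (f zero) ⟩
  f zero                          ≡.∎
sum-𝟙 {suc n} (suc w) f = trans (sum-cong-≗ λ u → cong (_* f (suc u)) (𝟙-suc u)) (sum-𝟙 w (f ∘ suc))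
  where
  𝟙-suc : ∀ u → 𝟙 (suc w Fin.≟ suc u) ≡ 𝟙 (w Fin.≟ u)
  𝟙-suc u with w Fin.≟ u
  ... | yes _ = refl
  ... | no  _ = refl

-- By uniqueness the count for `P` is at most 1, so a single solution of `Q` outweighs it.
count-mono : ∀ {n} {P Q : Fin n → Set} (P? : ∀ i → Dec (P i)) (Q? : ∀ i → Dec (Q i)) →
             (∀ {i j} → P i → P j → i ≡ j) → (∀ {i} → P i → ∃ Q) →
             sum (𝟙 ∘ P?) ≤ sum (𝟙 ∘ Q?)
count-mono {n} P? Q? unique transfer with Fin.any? P?
... | no  none = begin
  sum (𝟙 ∘ P?)      ≤⟨ sum-mono none≤0 ⟩
  sum {n} (λ _ → 0) ≡⟨ sum-replicate-zero n ⟩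
  0                 ≤⟨ z≤n ⟩
  sum (𝟙 ∘ Q?)      ∎
  where
  none≤0 : ∀ i → 𝟙 (P? i) ≤ 0
  none≤0 i with P? i
  ... | yes p = contradiction (i , p) none
  ... | no  _ = ≤-refl
... | yes (i , p) = begin
  sum (𝟙 ∘ P?)                     ≤⟨ sum-mono only-i ⟩
  sum (λ j → 𝟙 (i Fin.≟ j) * 1)    ≡⟨ sum-𝟙 i (λ _ → 1) ⟩
  1                                ≤⟨ attained (transfer p) ⟩
  sum (𝟙 ∘ Q?)                     ∎
  where
  only-i : ∀ j → 𝟙 (P? j) ≤ 𝟙 (i Fin.≟ j) * 1
  only-i j with P? j | i Fin.≟ j
  ... | yes q | yes _  = ≤-refl
  ... | yes q | no i≢j = contradiction (unique p q) i≢j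
  ... | no  _ | _      = z≤n
  attained : ∃ _ → 1 ≤ sum (𝟙 ∘ Q?)
  attained (j , q) = ≤-trans (holds (Q? j)) (term≤sum (𝟙 ∘ Q?) j)
    where
    holds : ∀ d → 1 ≤ 𝟙 d
    holds (yes _) = ≤-refl
    holds (no ¬q) = contradiction q ¬q

-- Walks that avoid a node

unless : ∀ {P : Set} → Dec P → ℕ → ℕ
unless (yes _) _ = 0
unless (no _)  m = m

-- A path of at most `N` edges, with `2 * N ^ 3` steps allotted to each edge.
halving-time : ℕ → ℕ
halving-time N = N * (2 * (N * (N * N)))

-- In a table, δ u x is the node reached from u by the instruction x.
Table : ℕ → ℕ → Set
Table n N = Fin n → Fin N → Fin n

-- The number of sequences of k instructions along which a walk from u avoids t.
avoiding : ∀ {n N} → Table n N → Fin n → ℕ → Fin n → ℕ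
avoiding δ t zero    u = unless (t Fin.≟ u) 1
avoiding δ t (suc k) u = unless (t Fin.≟ u) (sum λ x → avoiding δ t k (δ u x))

module _ {n N} (δ : Table n N) where

  private
    h : Fin n → ℕ → Fin n → ℕ
    h = avoiding δ

  avoiding-target : ∀ t k → h t k t ≡ 0
  avoiding-target t zero with t Fin.≟ t
  ... | yes _  = refl
  ... | no t≢t = contradiction refl t≢t
  avoiding-target t (suc k) with t Fin.≟ t
  ... | yes _  = refl
  ... | no t≢t = contradiction refl t≢t

  -- Dropping the last instruction of an avoiding sequence leaves an avoiding one, and that
  -- instruction has at most `N` values.
  avoiding-suc : ∀ t k u → h t (suc k) u ≤ N * h t k u
  avoiding-suc t k u with t Fin.≟ u in eq
  ... | yes _ = z≤n
  -- The right-hand side tests `u` as well, which shows only once `k` is split; `eq` settles that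
  -- test.
  avoiding-suc t zero u    | no _ rewrite eq =
    ≤-trans (sum-mono (λ x → ≤1 (t Fin.≟ δ u x))) (≤-reflexive (sum-const N 1))
    where
    ≤1 : ∀ {P : Set} (d : Dec P) → unless d 1 ≤ 1
    ≤1 (yes _) = z≤n
    ≤1 (no _)  = ≤-refl
  avoiding-suc t (suc k) u | no _ rewrite eq = begin
    sum (λ x → h t (suc k) (δ u x))   ≤⟨ sum-mono (λ x → avoiding-suc t k (δ u x)) ⟩
    sum (λ x → N * h t k (δ u x))     ≡⟨ *-distribˡ-sum N (λ x → h t k (δ u x)) ⟨
    N * sum (λ x → h t k (δ u x))     ∎

  avoiding-+ : ∀ t j k u → h t (j + k) u ≤ N ^ j * h t k u
  avoiding-+ t zero    k u = ≤-reflexive (sym (+-identityʳ _))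
  avoiding-+ t (suc j) k u = begin
    h t (suc j + k) u      ≤⟨ avoiding-suc t (j + k) u ⟩
    N * h t (j + k) u      ≤⟨ *-monoʳ-≤ N (avoiding-+ t j k u) ⟩
    N * (N ^ j * h t k u)  ≡⟨ *-assoc N (N ^ j) _ ⟨
    N ^ suc j * h t k u    ∎

  avoiding≤^ : ∀ t k u → h t k u ≤ N ^ k
  avoiding≤^ t zero    u with t Fin.≟ u
  ... | yes _ = z≤n
  ... | no  _ = ≤-refl
  avoiding≤^ t (suc k) u = ≤-trans (avoiding-suc t k u) (*-monoʳ-≤ N (avoiding≤^ t k u))

  -- A walk that meets s within j steps still has to avoid t for k steps from
  -- there.
  avoiding-via : ∀ s t j k u → h t (j + k) u ≤ N ^ k * h s j u + N ^ j * h t k s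
  avoiding-via s t j k u with s Fin.≟ u in eq
  ... | yes refl = ≤-trans (avoiding-+ t j k s) (m≤n+m _ _)
  avoiding-via s t zero k u    | no _ rewrite eq = begin
    h t k u                           ≤⟨ avoiding≤^ t k u ⟩
    N ^ k                             ≡⟨ *-identityʳ (N ^ k) ⟨
    N ^ k * 1                         ≤⟨ m≤m+n _ _ ⟩
    N ^ k * 1 + N ^ 0 * h t k s       ∎
  avoiding-via s t (suc j) k u | no _ rewrite eq = begin
    h t (suc j + k) u                                                         ≤⟨ unless≤ (t Fin.≟ u) ⟩
    sum (λ x → h t (j + k) (δ u x))                                           ≤⟨ sum-mono (λ x → avoiding-via s t j k (δ u x)) ⟩
    sum (λ x → N ^ k * h s j (δ u x) + N ^ j * h t k s)                       ≡⟨ ∑-distrib-+ (λ x → N ^ k * h s j (δ u x)) _ ⟩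
    sum (λ x → N ^ k * h s j (δ u x)) + sum {N} (λ x → N ^ j * h t k s)       ≡⟨ cong₂ _+_ (sym (*-distribˡ-sum (N ^ k) (λ x → h s j (δ u x)))) (sum-const N _) ⟩
    N ^ k * sum (λ x → h s j (δ u x)) + N * (N ^ j * h t k s)                 ≡⟨ cong (N ^ k * sum (λ x → h s j (δ u x)) +_) (*-assoc N (N ^ j) _) ⟨
    N ^ k * sum (λ x → h s j (δ u x)) + N ^ suc j * h t k s                   ∎
    where
    unless≤ : ∀ {P : Set} (d : Dec P) {m} → unless d m ≤ m
    unless≤ (yes _) = z≤n
    unless≤ (no _)  = ≤-refl

  module _ {t W} (half : ∀ u → 2 * h t W u ≤ N ^ W) where

    -- `half` is uniform in the node, so it applies wherever the first `j` steps lead.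
    avoiding-halves : ∀ j u → 2 * h t (j + W) u ≤ N ^ W * h t j u
    avoiding-halves j u with t Fin.≟ u in eq
    avoiding-halves zero    u | yes refl rewrite avoiding-target t W = z≤n
    avoiding-halves (suc j) u | yes refl rewrite eq = z≤n
    avoiding-halves zero    u | no _ rewrite eq = ≤-trans (half u) (≤-reflexive (sym (*-identityʳ (N ^ W))))
    avoiding-halves (suc j) u | no _ rewrite eq = begin
      2 * sum (λ x → h t (j + W) (δ u x))      ≡⟨ *-distribˡ-sum 2 (λ x → h t (j + W) (δ u x)) ⟩
      sum (λ x → 2 * h t (j + W) (δ u x))      ≤⟨ sum-mono (λ x → avoiding-halves j (δ u x)) ⟩
      sum (λ x → N ^ W * h t j (δ u x))        ≡⟨ *-distribˡ-sum (N ^ W) (λ x → h t j (δ u x)) ⟨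
      N ^ W * sum (λ x → h t j (δ u x))        ∎

    avoiding-decays : ∀ K u → 2 ^ K * h t (K * W) u ≤ N ^ (K * W)
    avoiding-decays zero    u = ≤-trans (≤-reflexive (+-identityʳ _)) (avoiding≤^ t 0 u)
    avoiding-decays (suc K) u = begin
      2 * 2 ^ K * h t (W + K * W) u      ≡⟨ cong (λ k → 2 * 2 ^ K * h t k u) (+-comm W (K * W)) ⟩
      2 * 2 ^ K * h t (K * W + W) u      ≡⟨ trans (cong (_* h t (K * W + W) u) (*-comm 2 (2 ^ K))) (*-assoc (2 ^ K) 2 _) ⟩
      2 ^ K * (2 * h t (K * W + W) u)    ≤⟨ *-monoʳ-≤ (2 ^ K) (avoiding-halves (K * W) u) ⟩
      2 ^ K * (N ^ W * h t (K * W) u)    ≡⟨ *-swap (2 ^ K) (N ^ W) _ ⟩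
      N ^ W * (2 ^ K * h t (K * W) u)    ≤⟨ *-monoʳ-≤ (N ^ W) (avoiding-decays K u) ⟩
      N ^ W * N ^ (K * W)                ≡⟨ ^-distribˡ-+-* N W (K * W) ⟨
      N ^ (W + K * W)                    ∎

  data Path : ℕ → Fin n → Fin n → Set where
    []  : ∀ {u} → Path 0 u u
    _∷_ : ∀ {d u w} x → Path d (δ u x) w → Path (suc d) u w

  _++ₚ_ : ∀ {d e u v w} → Path d u v → Path e v w → Path (d + e) u w
  []       ++ₚ q = q
  (x ∷ p)  ++ₚ q = x ∷ (p ++ₚ q)

  node : ∀ {d u w} → Path d u w → Fin (suc d) → Fin n
  node {u = u} p       zero    = u
  node         (x ∷ p) (suc i) = node p i

  takeₚ : ∀ {d u w} (p : Path d u w) i → Path (toℕ i) u (node p i)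
  takeₚ p       zero    = []
  takeₚ (x ∷ p) (suc i) = x ∷ takeₚ p i

  dropₚ : ∀ {d u w} (p : Path d u w) i → Path (d ∸ toℕ i) (node p i) w
  dropₚ p       zero    = p
  dropₚ (x ∷ p) (suc i) = dropₚ p i

  -- A walk of more than `n` steps repeats a node by the pigeonhole principle; cutting out the
  -- detour between the two visits shortens it.
  short-path : ∀ {u w} d → Path d u w → ∃ λ e → e ≤ n × Path e u w
  short-path {u} {w} = <-rec _ λ d rec p → case d rec p
    where
    case : ∀ d → (∀ {e} → e < d → Path e u w → ∃ λ e → e ≤ n × Path e u w) →
           Path d u w → ∃ λ e → e ≤ n × Path e u w
    case d rec p with d ≤? n
    ... | yes d≤n = d , d≤n , p
    ... | no  d≰n =
      let i , j , i<j , same = Fin.pigeonhole (m≤n⇒m≤1+n (≰⇒> d≰n)) (node p)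
      in  rec (begin-strict
            toℕ i + (d ∸ toℕ j)  <⟨ +-monoˡ-< (d ∸ toℕ j) i<j ⟩
            toℕ j + (d ∸ toℕ j)  ≡⟨ m+[n∸m]≡n (s≤s⁻¹ (Fin.toℕ<n j)) ⟩
            d                    ∎)
          (takeₚ p i ++ₚ subst (λ v → Path (d ∸ toℕ j) v w) (sym same) (dropₚ p j))

  -- What the table of a port graph satisfies: every move can be undone, and distinct instructions
  -- share a target only if they stay put, as ignored instructions do.
  module Symmetric
    (back   : ∀ u x → ∃ λ y → δ (δ u x) y ≡ u)
    (simple : ∀ {u x y} → δ u x ≢ u → δ u x ≡ δ u y → x ≡ y)
    where

    count : Fin n → Fin n → ℕ
    count u w = sum λ x → 𝟙 (δ u x Fin.≟ w)

    -- Between distinct nodes `simple` leaves at most one instruction, and `back` supplies one for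
    -- the opposite direction. So the transition counts are symmetric, and their columns sum to `N`
    -- like their rows.
    count-sym≤ : ∀ u w → count u w ≤ count w u
    count-sym≤ u w with u Fin.≟ w
    ... | yes refl = ≤-refl
    ... | no  u≢w  = count-mono (λ x → δ u x Fin.≟ w) (λ x → δ w x Fin.≟ u)
      (λ { refl δuy≡w → simple (u≢w ∘ sym) (sym δuy≡w) }) (λ { refl → back u _ })

    count-sum : ∀ w → sum (count w) ≡ N
    count-sum w = ≡.begin
      sum (λ u → sum λ x → 𝟙 (δ w x Fin.≟ u))        ≡.≡⟨ ∑-comm (λ u x → 𝟙 (δ w x Fin.≟ u)) ⟩
      sum (λ x → sum λ u → 𝟙 (δ w x Fin.≟ u))        ≡.≡⟨ sum-cong-≗ (λ x → sum-cong-≗ λ u → sym (*-identityʳ (𝟙 (δ w x Fin.≟ u)))) ⟩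
      sum (λ x → sum λ u → 𝟙 (δ w x Fin.≟ u) * 1)    ≡.≡⟨ sum-cong-≗ (λ x → sum-𝟙 (δ w x) (λ _ → 1)) ⟩
      sum {N} (λ x → 1)                              ≡.≡⟨ sum-const N 1 ⟩
      N * 1                                          ≡.≡⟨ *-identityʳ N ⟩
      N                                              ≡.∎

    -- The uniform distribution is stationary.
    sum-δ : ∀ f → sum (λ u → sum λ x → f (δ u x)) ≡ N * sum f
    sum-δ f = ≡.begin
      sum (λ u → sum λ x → f (δ u x))                             ≡.≡⟨ sum-cong-≗ (λ u → sum-cong-≗ λ x → sum-𝟙 (δ u x) f) ⟨
      sum (λ u → sum λ x → sum λ w → 𝟙 (δ u x Fin.≟ w) * f w)     ≡.≡⟨ sum-cong-≗ (λ u → ∑-comm λ x w → 𝟙 (δ u x Fin.≟ w) * f w) ⟩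
      sum (λ u → sum λ w → sum λ x → 𝟙 (δ u x Fin.≟ w) * f w)     ≡.≡⟨ sum-cong-≗ (λ u → sum-cong-≗ λ w → *-distribʳ-sum (f w) (λ x → 𝟙 (δ u x Fin.≟ w))) ⟨
      sum (λ u → sum λ w → count u w * f w)                       ≡.≡⟨ sum-cong-≗ (λ u → sum-cong-≗ λ w → cong (_* f w) (≤-antisym (count-sym≤ u w) (count-sym≤ w u))) ⟩
      sum (λ u → sum λ w → count w u * f w)                       ≡.≡⟨ ∑-comm (λ u w → count w u * f w) ⟩
      sum (λ w → sum λ u → count w u * f w)                       ≡.≡⟨ sum-cong-≗ (λ w → *-distribʳ-sum (f w) (count w)) ⟨
      sum (λ w → sum (count w) * f w)                             ≡.≡⟨ sum-cong-≗ (λ w → cong (_* f w) (count-sum w)) ⟩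
      sum (λ w → N * f w)                                         ≡.≡⟨ *-distribˡ-sum N f ⟨
      N * sum f                                                   ≡.∎

    -- The sequences of `suc k` instructions along which a walk from `t` does not return to `t`. The
    -- first instruction is split off because `avoiding` vanishes at the target.
    avoiding-return : Fin n → ℕ → ℕ
    avoiding-return t k = sum λ x → h t k (δ t x)

    -- By stationarity the left side counts the walks of `suc k` steps from any node that avoid `t`
    -- after their start; on the right they are sorted by whether they start at `t`.
    sum-avoiding-suc : ∀ t k → N * sum (h t k) ≡ sum (h t (suc k)) + avoiding-return t k
    sum-avoiding-suc t k = ≡.begin
      N * sum (h t k)                                              ≡.≡⟨ sum-δ (h t k) ⟨
      sum (λ u → sum λ x → h t k (δ u x))                          ≡.≡⟨ sum-cong-≗ (λ u → split (t Fin.≟ u) _) ⟩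
      sum (λ u → h t (suc k) u + 𝟙 (t Fin.≟ u) * sum λ x → h t k (δ u x))
                                                                   ≡.≡⟨ ∑-distrib-+ (h t (suc k)) _ ⟩
      sum (h t (suc k)) + sum (λ u → 𝟙 (t Fin.≟ u) * sum λ x → h t k (δ u x))
                                                                   ≡.≡⟨ cong (sum (h t (suc k)) +_) (sum-𝟙 t (λ u → sum λ x → h t k (δ u x))) ⟩
      sum (h t (suc k)) + avoiding-return t k                      ≡.∎
      where
      split : ∀ {P : Set} (d : Dec P) m → m ≡ unless d m + 𝟙 d * m
      split (yes _) m = sym (+-identityʳ m)
      split (no _)  m = sym (+-identityʳ m)

    -- A finite form of Kac's bound on the mean return time. In probabilities the preceding identity
    -- telescopes: the return terms for times below `k` and the remaining sum total at most `n`.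
    -- These terms do not increase, so each is at least the one for `k`.
    avoiding-return-bound : ∀ t k → k * avoiding-return t k + N * sum (h t k) ≤ N ^ suc k * n
    avoiding-return-bound t zero = begin
      N * sum (h t 0)           ≤⟨ *-monoʳ-≤ N (sum-mono (avoiding≤^ t 0)) ⟩
      N * sum {n} (λ _ → 1)     ≡⟨ cong (N *_) (trans (sum-const n 1) (*-identityʳ n)) ⟩
      N * n                     ≡⟨ cong (_* n) (*-identityʳ N) ⟨
      N ^ 1 * n                 ∎
    avoiding-return-bound t (suc k) = begin
      suc k * avoiding-return t (suc k) + N * sum (h t (suc k))          ≤⟨ +-monoˡ-≤ _ (*-monoʳ-≤ (suc k) return-suc) ⟩
      suc k * (N * avoiding-return t k) + N * sum (h t (suc k))          ≡⟨ regroup k N _ _ ⟩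
      N * (k * avoiding-return t k + (sum (h t (suc k)) + avoiding-return t k))  ≡⟨ cong (λ s → N * (k * avoiding-return t k + s)) (sum-avoiding-suc t k) ⟨
      N * (k * avoiding-return t k + N * sum (h t k))                    ≤⟨ *-monoʳ-≤ N (avoiding-return-bound t k) ⟩
      N * (N ^ suc k * n)                                                ≡⟨ *-assoc N (N ^ suc k) n ⟨
      N ^ suc (suc k) * n                                                ∎
      where
      regroup : ∀ k N r s → suc k * (N * r) + N * s ≡ N * (k * r + (s + r))
      regroup = solve-∀
      return-suc : avoiding-return t (suc k) ≤ N * avoiding-return t k
      return-suc = ≤-trans (sum-mono (λ x → avoiding-suc t k (δ t x)))
                           (≤-reflexive (sym (*-distribˡ-sum N (λ x → h t k (δ t x)))))

    -- Some instruction leads from `t` back to `u`, so walks from `u` that avoid `t` continue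
    -- non-returning walks from `t`.
    avoiding-neighbour : ∀ k u x → k * h (δ u x) k u ≤ N ^ suc k * n
    avoiding-neighbour k u x = begin
      k * h t k u                                       ≤⟨ *-monoʳ-≤ k (subst (λ v → h t k v ≤ avoiding-return t k) (proj₂ (back u x))
                                                             (term≤sum (λ y → h t k (δ t y)) (proj₁ (back u x)))) ⟩
      k * avoiding-return t k                           ≤⟨ m≤m+n _ _ ⟩
      k * avoiding-return t k + N * sum (h t k)         ≤⟨ avoiding-return-bound t k ⟩
      N ^ suc k * n                                     ∎
      where t = δ u x

    -- Each edge gets `T` steps and fails with probability at most `N * n / T`; `avoiding-via` is
    -- the union bound over the edges.
    avoiding-path : ∀ {d u t} → Path d u t → ∀ T → T * h t (d * T) u ≤ d * (N ^ suc (d * T) * n)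
    avoiding-path {u = u} [] T rewrite avoiding-target u 0 = ≤-reflexive (*-zeroʳ T)
    avoiding-path {suc d} {u} {t} (x ∷ p) T = begin
      T * h t (T + d * T) u                                                  ≤⟨ *-monoʳ-≤ T (avoiding-via s t T (d * T) u) ⟩
      T * (N ^ (d * T) * h s T u + N ^ T * h t (d * T) s)                    ≡⟨ distribute T (N ^ (d * T)) (N ^ T) _ _ ⟩
      N ^ (d * T) * (T * h s T u) + N ^ T * (T * h t (d * T) s)              ≤⟨ +-mono-≤ (*-monoʳ-≤ (N ^ (d * T)) (avoiding-neighbour T u x))
                                                                                         (*-monoʳ-≤ (N ^ T) (avoiding-path p T)) ⟩
      N ^ (d * T) * (N ^ suc T * n) + N ^ T * (d * (N ^ suc (d * T) * n))    ≡⟨ collect (N ^ (d * T)) (N ^ T) N n d ⟩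
      suc d * (N * (N ^ T * N ^ (d * T)) * n)                                ≡⟨ cong (λ m → suc d * (N * m * n)) (^-distribˡ-+-* N T (d * T)) ⟨
      suc d * (N ^ suc (T + d * T) * n)                                      ∎
      where
      s = δ u x
      distribute : ∀ T b a y z → T * (b * y + a * z) ≡ b * (T * y) + a * (T * z)
      distribute = solve-∀
      collect : ∀ b a N n d → b * (N * a * n) + a * (d * (N * b * n)) ≡ suc d * (N * (a * b) * n)
      collect = solve-∀

    -- At most `N` edges failing with probability at most `N * N / T` each give one half for
    -- `T = 2 * N³`.
    avoiding-half : .{{_ : NonZero N}} → n ≤ N → ∀ {d u t} → Path d u t →
                    2 * h t (halving-time N) u ≤ N ^ halving-time N
    avoiding-half n≤N {d} {u} {t} path =
      let e , e≤n , p = short-path d path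
          e≤N = ≤-trans e≤n n≤N
      in  *-cancelˡ-≤ N³ {{m*n≢0 N (N * N) {{it}} {{m*n≢0 N N}}}} (begin
        N³ * (2 * h t (N * T) u)                              ≡⟨ trans (sym (*-assoc N³ 2 _)) (cong (_* h t (N * T) u) (*-comm N³ 2)) ⟩
        T * h t (N * T) u                                     ≡⟨ cong (λ k → T * h t k u) (length-split e≤N) ⟨
        -- The shortened path may have fewer than `N` edges; the steps left over can only help.
        T * h t ((N ∸ e) * T + e * T) u                       ≤⟨ *-monoʳ-≤ T (avoiding-+ t ((N ∸ e) * T) (e * T) u) ⟩
        T * (N ^ ((N ∸ e) * T) * h t (e * T) u)               ≡⟨ *-swap T (N ^ ((N ∸ e) * T)) _ ⟩
        N ^ ((N ∸ e) * T) * (T * h t (e * T) u)               ≤⟨ *-monoʳ-≤ (N ^ ((N ∸ e) * T)) (avoiding-path p T) ⟩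
        N ^ ((N ∸ e) * T) * (e * (N ^ suc (e * T) * n))       ≤⟨ *-monoʳ-≤ (N ^ ((N ∸ e) * T)) (*-mono-≤ e≤N (*-monoʳ-≤ (N ^ suc (e * T)) n≤N)) ⟩
        N ^ ((N ∸ e) * T) * (N * (N * N ^ (e * T) * N))       ≡⟨ collect (N ^ ((N ∸ e) * T)) (N ^ (e * T)) N ⟩
        N³ * (N ^ ((N ∸ e) * T) * N ^ (e * T))                ≡⟨ cong (N³ *_) (^-distribˡ-+-* N ((N ∸ e) * T) (e * T)) ⟨
        N³ * N ^ ((N ∸ e) * T + e * T)                        ≡⟨ cong (λ k → N³ * N ^ k) (length-split e≤N) ⟩
        N³ * N ^ (N * T)                                      ∎)
      where
      N³ = N * (N * N)
      T  = 2 * N³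
      length-split : ∀ {e} → e ≤ N → (N ∸ e) * T + e * T ≡ N * T
      length-split {e} e≤N = trans (sym (*-distribʳ-+ T (N ∸ e) e)) (cong (_* T) (m∸n+n≡m e≤N))
      collect : ∀ a b N → a * (N * (N * b * N)) ≡ N * (N * N) * (a * b)
      collect = solve-∀

-- Universal instruction sequences

-- The method of conditional expectations: g k i is the number of instruction
-- sequences of length k that fail for i.
derandomise : ∀ {I : Set} {N} .{{_ : NonZero N}} (act : I → Fin N → I) (g : ℕ → I → ℕ) →
              (∀ k i → sum (λ x → g k (act i x)) ≤ g (suc k) i) →
              ∀ {J} k (family : Fin J → I) →
              ∃ λ xs → length xs ≡ k ×
                N ^ k * sum (λ j → g 0 (foldl act (family j) xs)) ≤ sum (λ j → g k (family j))
derandomise act g g-step zero family = [] , refl , ≤-reflexive (+-identityʳ _)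
derandomise {N = N} act g g-step (suc k) family =
  -- An instruction that is no worse than average keeps the expected number of failures over the
  -- whole family from growing.
  let x , x-good          = below-average (λ x → sum λ j → g k (act (family j) x))
      xs , ∣xs∣ , xs-good = derandomise act g g-step k (λ j → act (family j) x)
      failures            = sum λ j → g 0 (foldl act (act (family j) x) xs)
  in  x ∷ xs , cong suc ∣xs∣ , (begin
    N * N ^ k * failures                              ≡⟨ *-assoc N (N ^ k) failures ⟩
    N * (N ^ k * failures)                            ≤⟨ *-monoʳ-≤ N xs-good ⟩
    N * sum (λ j → g k (act (family j) x))            ≤⟨ x-good ⟩
    sum (λ x → sum λ j → g k (act (family j) x))      ≡⟨ ∑-comm (λ x j → g k (act (family j) x)) ⟩
    sum (λ j → sum λ x → g k (act (family j) x))      ≤⟨ sum-mono (λ j → g-step k (family j)) ⟩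
    sum (λ j → g (suc k) (family j))                  ∎)

absorb : ∀ {n} {P : Set} → Dec P → Fin n → Fin n → Fin n
absorb (yes _) u w = u
absorb (no _)  u w = w

-- The walk stops at t.
stepTo : ∀ {n N} → Table n N → Fin n → Fin n → Fin N → Fin n
stepTo δ t u x = absorb (t Fin.≟ u) u (δ u x)

walkTo : ∀ {n N} → Table n N → Fin n → Fin n → List (Fin N) → Fin n
walkTo δ t = foldl (stepTo δ t)

avoiding-stepTo : ∀ {n N} (δ : Table n N) t k u →
                  sum (λ x → avoiding δ t k (stepTo δ t u x)) ≤ avoiding δ t (suc k) u
avoiding-stepTo {N = N} δ t k u with t Fin.≟ u
... | no _     = ≤-refl
... | yes refl = begin
  sum {N} (λ x → avoiding δ t k t)  ≤⟨ sum-mono {N} (λ x → ≤-reflexive (avoiding-target δ t k)) ⟩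
  sum {N} (λ _ → 0)                 ≡⟨ sum-replicate-zero N ⟩
  0                                 ∎

avoiding-zero : ∀ {n N} (δ : Table n N) {t u} → avoiding δ t 0 u ≡ 0 → u ≡ t
avoiding-zero δ {t} {u} eq with t Fin.≟ u
... | yes t≡u = sym t≡u
avoiding-zero δ () | no _

-- Makes a table on fewer nodes part of one on `N` nodes, so that one finite family of instances
-- serves all sizes up to `N`.
module _ {n n′ N} {δ : Table n N} {δ′ : Table n′ N} {ι : Fin n → Fin n′}
         (ι-injective : Injective _≡_ _≡_ ι) (ι-δ : ∀ u x → δ′ (ι u) x ≡ ι (δ u x)) where

  unless-embed : ∀ t u {m} → unless (ι t Fin.≟ ι u) m ≡ unless (t Fin.≟ u) m
  unless-embed t u with ι t Fin.≟ ι u | t Fin.≟ u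
  ... | yes _     | yes _  = refl
  ... | yes ιt≡ιu | no t≢u = contradiction (ι-injective ιt≡ιu) t≢u
  ... | no ιt≢ιu  | yes eq = contradiction (cong ι eq) ιt≢ιu
  ... | no _      | no _   = refl

  avoiding-embed : ∀ t k u → avoiding δ′ (ι t) k (ι u) ≡ avoiding δ t k u
  avoiding-embed t zero    u = unless-embed t u
  avoiding-embed t (suc k) u = trans (unless-embed t u) (cong (unless (t Fin.≟ u)) (sum-cong-≗ λ x →
    trans (cong (avoiding δ′ (ι t) k) (ι-δ u x)) (avoiding-embed t k (δ u x))))

  stepTo-embed : ∀ t u x → stepTo δ′ (ι t) (ι u) x ≡ ι (stepTo δ t u x)
  stepTo-embed t u x with ι t Fin.≟ ι u | t Fin.≟ u
  ... | yes _     | yes _  = refl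
  ... | yes ιt≡ιu | no t≢u = contradiction (ι-injective ιt≡ιu) t≢u
  ... | no ιt≢ιu  | yes eq = contradiction (cong ι eq) ιt≢ιu
  ... | no _      | no _   = ι-δ u x

  walkTo-embed : ∀ t u xs → walkTo δ′ (ι t) (ι u) xs ≡ ι (walkTo δ t u xs)
  walkTo-embed t u []       = refl
  walkTo-embed t u (x ∷ xs) =
    trans (cong (λ v → walkTo δ′ (ι t) v xs) (stepTo-embed t u x)) (walkTo-embed t (stepTo δ t u x) xs)

-- 2 ^ repetitions N exceeds the number of instances: a table, a target and a
-- starting node.
repetitions : ℕ → ℕ
repetitions N = suc (N * (N * N + 2))

walk-length : ℕ → ℕ
walk-length N = repetitions N * halving-time N

RarelyAvoids : ∀ {n N} → Table n N → Fin n → Fin n → Set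
RarelyAvoids {N = N} δ t u = 2 ^ repetitions N * avoiding δ t (walk-length N) u ≤ N ^ walk-length N

module _ (N : ℕ) .{{_ : NonZero N}} where

  private
    #tables #instances : ℕ
    #tables    = (N ^ N) ^ N
    #instances = #tables * (N * N)

    -- Tables are numbered so that instances form a family over some `Fin`, over which failures can
    -- be summed.
    table : Fin #tables → Table N N
    table c u = finToFun {N} {N} (finToFun {N ^ N} {N} c u)

    tabulate : Table N N → Fin #tables
    tabulate δ = funToFin {N} {N ^ N} λ u → funToFin {N} {N} (δ u)

    table-tabulate : ∀ δ u x → table (tabulate δ) u x ≡ δ u x
    table-tabulate δ u x = trans (cong (λ c → finToFun {N} {N} c x) (Fin.finToFun-funToFin (λ u → funToFin (δ u)) u))
                                 (Fin.finToFun-funToFin (δ u) x)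

    Instance : Set
    Instance = Fin #tables × Fin N × Fin N

    act : Instance → Fin N → Instance
    act (c , t , u) x = c , t , stepTo (table c) t u x

    g : ℕ → Instance → ℕ
    g k (c , t , u) = avoiding (table c) t k u

    Rarely : Instance → Set
    Rarely (c , t , u) = RarelyAvoids (table c) t u

    rarely? : ∀ i → Dec (Rarely i)
    rarely? (c , t , u) = _ ≤? _

    decode : Fin #instances → Instance
    decode j = map₂ (remQuot {N} N) (remQuot {#tables} (N * N) j)

    decode-combine : ∀ c t u → decode (combine c (combine t u)) ≡ (c , t , u)
    decode-combine c t u = trans (cong (map₂ (remQuot {N} N)) (Fin.remQuot-combine c (combine t u)))
                                 (cong (c ,_) (Fin.remQuot-combine t u))

    -- An instance about which nothing is known is replaced by one whose walk
    -- starts at its target.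
    admissible : ∀ i → Dec (Rarely i) → Instance
    admissible i           (yes _) = i
    admissible (c , t , _) (no _)  = c , t , t

    admissible-rarely : ∀ i d → Rarely (admissible i d)
    admissible-rarely i           (yes rarely) = rarely
    admissible-rarely (c , t , _) (no _)       =
      ≤-trans (≤-reflexive (trans (cong (2 ^ repetitions N *_) (avoiding-target (table c) t (walk-length N)))
                                  (*-zeroʳ (2 ^ repetitions N)))) z≤n

    admissible-id : ∀ i d → Rarely i → admissible i d ≡ i
    admissible-id i (yes _)      _      = refl
    admissible-id i (no ¬rarely) rarely = contradiction rarely ¬rarely

    instance-of : Fin #instances → Instance
    instance-of j = admissible (decode j) (rarely? (decode j))

    #instances< : #instances < 2 ^ repetitions N
    #instances< = begin-strict
      (N ^ N) ^ N * (N * N)          ≡⟨ cong₂ _*_ (^-*-assoc N N N) (cong (N *_) (sym (*-identityʳ N))) ⟩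
      N ^ (N * N) * N ^ 2            ≡⟨ ^-distribˡ-+-* N (N * N) 2 ⟨
      N ^ (N * N + 2)                ≤⟨ ^-monoˡ-≤ (N * N + 2) (<⇒≤ (n<2^n N)) ⟩
      (2 ^ N) ^ (N * N + 2)          ≡⟨ ^-*-assoc 2 N (N * N + 2) ⟩
      2 ^ (N * (N * N + 2))          <⟨ ^-monoʳ-< 2 ≤-refl (n<1+n (N * (N * N + 2))) ⟩
      2 ^ repetitions N              ∎

    sequence = derandomise act g (λ k (c , t , u) → avoiding-stepTo (table c) t k u) (walk-length N) instance-of

    failures : ℕ
    failures = sum λ j → g 0 (foldl act (instance-of j) (proj₁ sequence))

    -- Union bound: each instance fails with probability at most one in `2 ^ K`, and there are fewer
    -- than `2 ^ K` instances. The number of failures is then a natural number below 1.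
    no-failures : failures ≡ 0
    no-failures = n<1⇒n≡0 (*-cancelˡ-< (N ^ W) _ _ (*-cancelˡ-< (2 ^ K) _ _ (begin-strict
      2 ^ K * (N ^ W * failures)                        ≤⟨ *-monoʳ-≤ (2 ^ K) (proj₂ (proj₂ sequence)) ⟩
      2 ^ K * sum (λ j → g W (instance-of j))           ≡⟨ *-distribˡ-sum (2 ^ K) (λ j → g W (instance-of j)) ⟩
      sum (λ j → 2 ^ K * g W (instance-of j))           ≤⟨ sum-mono (λ j → admissible-rarely (decode j) (rarely? (decode j))) ⟩
      sum {#instances} (λ j → N ^ W)                    ≡⟨ sum-const #instances (N ^ W) ⟩
      #instances * N ^ W                                <⟨ *-monoˡ-< (N ^ W) {{m^n≢0 N W}} #instances< ⟩
      2 ^ K * N ^ W                                     ≡⟨ cong (2 ^ K *_) (*-identityʳ (N ^ W)) ⟨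
      2 ^ K * (N ^ W * 1)                               ∎)))
      where
      K = repetitions N
      W = walk-length N

    walk-instance : ∀ c t u xs → foldl act (c , t , u) xs ≡ (c , t , walkTo (table c) t u xs)
    walk-instance c t u []       = refl
    walk-instance c t u (x ∷ xs) = walk-instance c t _ xs

    sequence-visits-table : ∀ c {t u} → RarelyAvoids (table c) t u → walkTo (table c) t u (proj₁ sequence) ≡ t
    sequence-visits-table c {t} {u} small = avoiding-zero (table c) (≡.begin
      g 0 (c , t , walkTo (table c) t u (proj₁ sequence))  ≡.≡⟨ cong (g 0) (walk-instance c t u (proj₁ sequence)) ⟨
      g 0 (foldl act (c , t , u) (proj₁ sequence))         ≡.≡⟨ cong (λ i → g 0 (foldl act i (proj₁ sequence))) (sym instance-of-j) ⟩
      g 0 (foldl act (instance-of j) (proj₁ sequence))     ≡.≡⟨ term≡0 _ no-failures j ⟩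
      0                                                    ≡.∎)
      where
      j = combine c (combine t u)
      instance-of-j : instance-of j ≡ (c , t , u)
      instance-of-j = trans (cong (λ i → admissible i (rarely? i)) (decode-combine c t u)) (admissible-id _ (rarely? _) small)

    sequence-visits : ∀ {n} → n ≤ N → (δ : Table n N) → ∀ t u → RarelyAvoids δ t u →
                      walkTo δ t u (proj₁ sequence) ≡ t
    sequence-visits {n} n≤N δ t u small = ι-injective (≡.begin
      ι (walkTo δ t u (proj₁ sequence))             ≡.≡⟨ walkTo-embed ι-injective ι-δ t u (proj₁ sequence) ⟨
      walkTo (table c) (ι t) (ι u) (proj₁ sequence) ≡.≡⟨ sequence-visits-table c (subst (λ m → 2 ^ repetitions N * m ≤ N ^ walk-length N)
                                                    (sym (avoiding-embed ι-injective ι-δ t (walk-length N) u)) small) ⟩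
      ι t                                           ≡.∎)
      where
      ι : Fin n → Fin N
      ι u = inject≤ u n≤N
      ι-injective : Injective _≡_ _≡_ ι
      ι-injective = Fin.inject≤-injective n≤N n≤N _ _
      -- Nodes outside the image of `ι` get loops; walks that start in the image stay there.
      extend : (u : Fin N) → Dec (toℕ u < n) → Fin N → Fin N
      extend u (yes u<n) x = ι (δ (fromℕ< u<n) x)
      extend u (no _)    x = u
      c = tabulate λ u → extend u (toℕ u <? n)
      extend-ι : ∀ u x d → extend (ι u) d x ≡ ι (δ u x)
      extend-ι u x (yes u<n) = cong (λ v → ι (δ v x)) (Fin.toℕ-injective (trans (Fin.toℕ-fromℕ< u<n) (Fin.toℕ-inject≤ u n≤N)))
      extend-ι u x (no u≮n)  = contradiction (subst (_< n) (sym (Fin.toℕ-inject≤ u n≤N)) (Fin.toℕ<n u)) u≮n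
      ι-δ : ∀ u x → table c (ι u) x ≡ ι (δ u x)
      ι-δ u x = trans (table-tabulate _ (ι u) x) (extend-ι u x (toℕ (ι u) <? n))

  -- Opaque, so that the search behind the sequence is never evaluated.
  abstract
    universal : List (Fin N)
    universal = proj₁ sequence

    length-universal : length universal ≡ walk-length N
    length-universal = proj₁ (proj₂ sequence)

    universal-visits : ∀ {n} → n ≤ N → (δ : Table n N) → ∀ t u → RarelyAvoids δ t u →
                       walkTo δ t u universal ≡ t
    universal-visits = sequence-visits

-- Obeying instructions in a port graph

module _ {n N} (G : PortGraph n) (n≤N : n ≤ N) where

  -- Instructions that are not ports are ignored.
  graphTable : Table n N
  graphTable u x with toℕ x <? deg G u
  ... | yes x<d = neighbour G u (fromℕ< x<d)
  ... | no  _   = u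

  graphTable-yes : ∀ {u x} (x<d : toℕ x < deg G u) → graphTable u x ≡ neighbour G u (fromℕ< x<d)
  graphTable-yes {u} {x} x<d with toℕ x <? deg G u
  ... | yes _   = refl
  ... | no  x≮d = contradiction x<d x≮d

  graphTable-no : ∀ {u x} → ¬ toℕ x < deg G u → graphTable u x ≡ u
  graphTable-no {u} {x} x≮d with toℕ x <? deg G u
  ... | yes x<d = contradiction x<d x≮d
  ... | no  _   = refl

  deg≤ : ∀ u → deg G u ≤ N
  deg≤ u = ≤-trans (Fin.injective⇒≤ (λ {p} {q} → no-multiple-edge G u p q)) n≤N

  graphTable-port : ∀ u p → graphTable u (inject≤ p (deg≤ u)) ≡ neighbour G u p
  graphTable-port u p = trans (graphTable-yes x<d)
    (cong (neighbour G u) (Fin.toℕ-injective (trans (Fin.toℕ-fromℕ< x<d) (Fin.toℕ-inject≤ p (deg≤ u)))))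
    where
    x<d : toℕ (inject≤ p (deg≤ u)) < deg G u
    x<d = subst (_< deg G u) (sym (Fin.toℕ-inject≤ p (deg≤ u))) (Fin.toℕ<n p)

  -- An edge is undone by its port at the other end, an ignored instruction by itself.
  graphTable-back : ∀ u x → ∃ λ y → graphTable (graphTable u x) y ≡ u
  graphTable-back u x with toℕ x <? deg G u
  ... | yes x<d = let w , q = rot G (u , fromℕ< x<d) in
        inject≤ q (deg≤ w) , trans (graphTable-port w q) (cong proj₁ (rot-involutive G (u , fromℕ< x<d)))
  ... | no  x≮d = x , graphTable-no x≮d

  graphTable-simple : ∀ {u x y} → graphTable u x ≢ u → graphTable u x ≡ graphTable u y → x ≡ y
  graphTable-simple {u} {x} {y} moves same with toℕ x <? deg G u | toℕ y <? deg G u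
  ... | no _    | _       = contradiction refl moves
  ... | yes _   | no _    = contradiction same moves
  ... | yes x<d | yes y<d = Fin.toℕ-injective (Fin.fromℕ<-injective _ _ x<d y<d (no-multiple-edge G u _ _ same))

  graphTable-path : ∀ {u w} → Star (Adjacent G) u w → ∃ λ d → Path graphTable d u w
  graphTable-path ε = 0 , []
  graphTable-path ((p , refl) ◅ path) =
    let d , q = graphTable-path path
    in  suc d , inject≤ p (deg≤ _) ∷ subst (λ v → Path graphTable d v _) (sym (graphTable-port _ p)) q

  graphTable-rarely-avoids : .{{_ : NonZero N}} → ∀ t u → RarelyAvoids graphTable t u
  graphTable-rarely-avoids t = avoiding-decays graphTable {t} {halving-time N}
    (λ u → avoiding-half n≤N (proj₂ (graphTable-path (connected G u t)))) (repetitions N)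
    where open Symmetric graphTable graphTable-back graphTable-simple

module _ {N : ℕ} where

  firstPort : ∀ d → List (Fin N) → Maybe (Fin d × List (Fin N))
  firstPort d []       = nothing
  firstPort d (x ∷ xs) with toℕ x <? d
  ... | yes x<d = just (fromℕ< x<d , xs)
  ... | no  _   = firstPort d xs

  firstPort-yes : ∀ {d x xs} (x<d : toℕ x < d) → firstPort d (x ∷ xs) ≡ just (fromℕ< x<d , xs)
  firstPort-yes {d} {x} x<d with toℕ x <? d
  ... | yes _   = refl
  ... | no  x≮d = contradiction x<d x≮d

  firstPort-no : ∀ {d x xs} → ¬ toℕ x < d → firstPort d (x ∷ xs) ≡ firstPort d xs
  firstPort-no {d} {x} x≮d with toℕ x <? d
  ... | yes x<d = contradiction x<d x≮d
  ... | no  _   = refl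

  -- The agent's only memory is its history, so the unread instructions are recomputed from the
  -- degrees met. The default `[]` concerns histories that go on after the list has run out.
  remaining : List (Fin N) → ∀ {d} → History d → List (Fin N)
  remaining xs (start d)            = xs
  remaining xs (move {d} h p d′ q)  = Maybe.maybe proj₂ [] (firstPort d (remaining xs h))

  obey : List (Fin N) → ∀ {d} → History d → Maybe (Fin d)
  obey xs {d} h = Maybe.map proj₁ (firstPort d (remaining xs h))

module _ {n N} (G : PortGraph n) (n≤N : n ≤ N) {A : Algorithm} {s xs₀}
         (obeys : ∀ {d} (h : History d) → A s h ≡ obey {N} xs₀ h) where

  private
    δ = graphTable G n≤N

  visits-∷ : ∀ {t u x xs ws} → (walkTo δ t (δ u x) xs ≡ t → t ∈ ws) →
             walkTo δ t u (x ∷ xs) ≡ t → t ∈ u ∷ ws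
  visits-∷ {t} {u} visits eq with t Fin.≟ u
  ... | yes t≡u = here t≡u
  ... | no  _   = there (visits eq)

  walkTo-ignored : ∀ {t u x} xs → δ u x ≡ u → walkTo δ t u (x ∷ xs) ≡ walkTo δ t u xs
  walkTo-ignored {t} {u} xs δux≡u with t Fin.≟ u
  ... | yes _ = refl
  ... | no  _ = cong (λ v → walkTo δ t v xs) δux≡u

  -- The agent knows no target and walks on where `walkTo` halts; so one run must serve all `t` at
  -- once.
  Visiting : List (Fin N) → ∀ u → History (deg G u) → Set
  Visiting xs u h = ∃ λ ws → Execution A s G u h ws
                           × (∀ t → walkTo δ t u xs ≡ t → t ∈ u ∷ ws)
                           × length ws ≤ length xs

  -- `firstPort` skips ignored instructions all at once, the induction one by one. Hence `xs` need
  -- agree with `remaining` only up to such instructions.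
  execution : ∀ xs u h → firstPort (deg G u) (remaining xs₀ h) ≡ firstPort (deg G u) xs → Visiting xs u h
  execution [] u h eq =
    [] , stop (trans (obeys h) (cong (Maybe.map proj₁) eq)) , (λ t u≡t → here (sym u≡t)) , z≤n
  execution (x ∷ xs) u h eq = by-cases (toℕ x <? deg G u)
    where
    by-cases : Dec (toℕ x < deg G u) → Visiting (x ∷ xs) u h
    by-cases (yes x<d) =
      let w , q = rot G (u , fromℕ< x<d)
          eq′   = trans eq (firstPort-yes x<d)
          ws , run , visits , short = execution xs w (move h (fromℕ< x<d) (deg G w) q)
            (cong (firstPort (deg G w) ∘ Maybe.maybe proj₂ []) eq′)
      in  w ∷ ws , step (trans (obeys h) (cong (Maybe.map proj₁) eq′)) refl run
        , (λ t → visits-∷ {t} {u} {x} {xs} λ δux→t → visits t (trans (cong (λ v → walkTo δ t v xs) (sym (graphTable-yes G n≤N x<d))) δux→t))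
        , s≤s short
    by-cases (no x≮d) =
      let ws , run , visits , short = execution xs u h (trans eq (firstPort-no x≮d))
      in  ws , run
        , (λ t u→t → visits t (trans (sym (walkTo-ignored xs (graphTable-no G n≤N x≮d))) u→t))
        , m≤n⇒m≤1+n short

-- Polynomial time with short advice

walk-length≤ : ∀ N .{{_ : NonZero N}} → walk-length N ≤ 8 * N ^ 7
walk-length≤ N = begin
  suc (N * (N * N + 2)) * halving-time N                         ≤⟨ *-monoˡ-≤ (halving-time N) K≤ ⟩
  4 * (N * (N * N)) * halving-time N                             ≡⟨ product N ⟩
  8 * N ^ 7                                                      ∎
  where
  product : ∀ N → 4 * (N * (N * N)) * (N * (2 * (N * (N * N)))) ≡ 8 * (N * (N * (N * (N * (N * (N * (N * 1)))))))
  product = solve-∀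
  expand : ∀ N → N * (N * N + 2) ≡ N * (N * N) + 2 * N
  expand = solve-∀
  N≤N³ : N ≤ N * (N * N)
  N≤N³ = m≤m*n N (N * N) {{m*n≢0 N N}}
  K≤ : suc (N * (N * N + 2)) ≤ 4 * (N * (N * N))
  K≤ = begin
    suc (N * (N * N + 2))                    ≡⟨ cong suc (expand N) ⟩
    suc (N * (N * N) + 2 * N)                ≤⟨ +-mono-≤ (≤-trans (>-nonZero⁻¹ N) N≤N³) (+-monoʳ-≤ (N * (N * N)) (*-monoʳ-≤ 2 N≤N³)) ⟩
    4 * (N * (N * N))                        ∎

-- From v = ⌊ ⌊log log n⌋ / 2^(c+1) ⌋ one recovers an upper bound for n.
sizeBound : ℕ → ℕ → ℕ
sizeBound c v = 2 ^ 2 ^ (suc v * 2 ^ suc c)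

⌊loglog⌋ : ℕ → ℕ
⌊loglog⌋ n = ⌊log₂ ⌊log₂ n ⌋ ⌋

-- The factor 2 is for `n = 1`, where `⌊loglog⌋ n` is 0 and the tower is 2.
2^2^⌊loglog⌋≤ : ∀ n .{{_ : NonZero n}} → 2 ^ 2 ^ ⌊loglog⌋ n ≤ 2 * n
2^2^⌊loglog⌋≤ 1 = ≤-refl
2^2^⌊loglog⌋≤ n@(2+ n′) = begin
  2 ^ 2 ^ ⌊loglog⌋ n  ≤⟨ ^-monoʳ-≤ 2 (⌊log₂⌋-lower ⌊log₂ n ⌋ {{>-nonZero (⌊log₂⌋-mono-≤ {2} {n} (s≤s (s≤s z≤n)))}}) ⟩
  2 ^ ⌊log₂ n ⌋       ≤⟨ ⌊log₂⌋-lower n ⟩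
  n                   ≤⟨ m≤m+n n _ ⟩
  2 * n               ∎

module _ (c n : ℕ) where

  private
    d x v : ℕ
    d = 2 ^ suc c
    x = ⌊loglog⌋ n

    instance
      d≢0 : NonZero d
      d≢0 = m^n≢0 2 (suc c)

    v = x / d

    x<[1+v]d : x < suc v * d
    x<[1+v]d = begin-strict
      x              ≡⟨ m≡m%n+[m/n]*n x d ⟩
      x % d + v * d  <⟨ +-monoˡ-< (v * d) (m%n<n x d) ⟩
      suc v * d      ∎

  loglogQuotient : ℕ
  loglogQuotient = v

  ≤sizeBound : n ≤ sizeBound c v
  ≤sizeBound = begin
    n                        ≤⟨ <⇒≤ (⌊log₂⌋-upper n) ⟩
    2 ^ suc ⌊log₂ n ⌋        ≤⟨ ^-monoʳ-≤ 2 (⌊log₂⌋-upper ⌊log₂ n ⌋) ⟩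
    2 ^ 2 ^ suc x            ≤⟨ ^-monoʳ-≤ 2 (^-monoʳ-≤ 2 x<[1+v]d) ⟩
    sizeBound c v            ∎

  -- Rounding up to the next multiple adds at most `d` to the double logarithm, that is, it raises
  -- the tower to the constant power `2 ^ d`.
  sizeBound≤ : .{{_ : NonZero n}} → sizeBound c v ≤ (2 * n) ^ 2 ^ d
  sizeBound≤ = begin
    2 ^ 2 ^ (d + v * d)        ≤⟨ ^-monoʳ-≤ 2 (^-monoʳ-≤ 2 (+-monoʳ-≤ d (m/n*n≤m x d))) ⟩
    2 ^ 2 ^ (d + x)            ≡⟨ cong (λ e → 2 ^ 2 ^ e) (+-comm d x) ⟩
    2 ^ 2 ^ (x + d)            ≡⟨ cong (2 ^_) (^-distribˡ-+-* 2 x d) ⟩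
    2 ^ (2 ^ x * 2 ^ d)        ≡⟨ ^-*-assoc 2 (2 ^ x) (2 ^ d) ⟨
    (2 ^ 2 ^ x) ^ 2 ^ d        ≤⟨ ^-monoˡ-≤ (2 ^ d) (2^2^⌊loglog⌋≤ n) ⟩
    (2 * n) ^ 2 ^ d            ∎

  -- Division by `d` takes `suc c` off the exponent in `x < 2 ^ suc y`; the 1 beyond `c` pays for
  -- the rounding of the outer logarithm.
  length-encode-loglogQuotient : length (encode v) ≤ logloglog n - c
  length-encode-loglogQuotient = ≮⇒≥ λ y∸c<length → 1+n≰n (begin
    suc (2 ^ (y ∸ c))         ≤⟨ ^-monoʳ-< 2 ≤-refl y∸c<length ⟩
    2 ^ length (encode v)     ≤⟨ value-lower (encode v) ⟩
    suc (value (encode v))    ≡⟨ cong suc (value-encode v) ⟩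
    suc v                     ≤⟨ v< ⟩
    2 ^ (y ∸ c)               ∎)
    where
    y = ⌊log₂ x ⌋
    v< : v < 2 ^ (y ∸ c)
    v< = *-cancelʳ-< d v (2 ^ (y ∸ c)) (begin-strict
      v * d                      ≤⟨ m/n*n≤m x d ⟩
      x                          <⟨ ⌊log₂⌋-upper x ⟩
      -- This covers `y < c` too: then `v` must be 0 and the advice is empty.
      2 ^ suc y                  ≤⟨ ^-monoʳ-≤ 2 (≤-trans (s≤s (m≤n+m∸n y c)) (≤-reflexive (+-comm (suc c) (y ∸ c)))) ⟩
      2 ^ (y ∸ c + suc c)        ≡⟨ ^-distribˡ-+-* 2 (y ∸ c) (suc c) ⟩
      2 ^ (y ∸ c) * d            ∎)

sizeBound-nonZero : ∀ c v → NonZero (sizeBound c v)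
sizeBound-nonZero c v = m^n≢0 2 (2 ^ (suc v * 2 ^ suc c))

module _ (c : ℕ) where

  oracle : MapOracle
  oracle {n} _ = encode (loglogQuotient c n)

  instructions : ∀ v → List (Fin (sizeBound c v))
  instructions v = universal (sizeBound c v) {{sizeBound-nonZero c v}}

  explorer : Algorithm
  explorer s = obey (instructions (value s))

  explorer-explores : ExploresInPolyTime explorer (toInstance oracle)
  -- From `N ≤ (2 * n) ^ D` and a walk of at most `8 * N ^ 7` steps.
  explorer-explores = 8 * 2 ^ (D * 7) , D * 7 , explores
    where
    D = 2 ^ 2 ^ suc c

    explores : ∀ {n} (G : PortGraph n) u →
               ExploresWithin explorer (oracle G) G u (8 * 2 ^ (D * 7) * n ^ (D * 7))
    explores {n} G u =
      let ws , run , visits , short = execution G n≤N {explorer} {oracle G} obeys (universal N) u (start _) refl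
      in  ws , run , (λ t → visits t (universal-visits N n≤N _ t u (graphTable-rarely-avoids G n≤N t u)))
        , (begin
          length ws                           ≤⟨ short ⟩
          length (universal N)                ≡⟨ length-universal N ⟩
          walk-length N                       ≤⟨ walk-length≤ N ⟩
          8 * N ^ 7                           ≤⟨ *-monoʳ-≤ 8 (^-monoˡ-≤ 7 (sizeBound≤ c n)) ⟩
          8 * ((2 * n) ^ D) ^ 7               ≡⟨ cong (8 *_) (^-*-assoc (2 * n) D 7) ⟩
          8 * (2 * n) ^ (D * 7)               ≡⟨ cong (8 *_) (^-distribʳ-* 2 n (D * 7)) ⟩
          8 * (2 ^ (D * 7) * n ^ (D * 7))     ≡⟨ *-assoc 8 (2 ^ (D * 7)) (n ^ (D * 7)) ⟨
          8 * 2 ^ (D * 7) * n ^ (D * 7)       ∎)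
      where
      N = sizeBound c (loglogQuotient c n)
      instance
        N≢0 : NonZero N
        N≢0 = sizeBound-nonZero c (loglogQuotient c n)
        n≢0 : NonZero n
        n≢0 = Fin.nonZeroIndex u
      n≤N = ≤sizeBound c n
      obeys : ∀ {d} (h : History d) → explorer (oracle G) h ≡ obey (universal N) h
      obeys h = cong (λ v → obey (instructions v) h) (value-encode (loglogQuotient c n))

-- Rings

next : ∀ {m} → Fin (suc m) → Fin (suc m)
next i with view i
... | ‵fromℕ     = zero
... | ‵inject₁ j = suc j

prev : ∀ {m} → Fin (suc m) → Fin (suc m)
prev zero    = fromℕ _
prev (suc j) = inject₁ j

prev-next : ∀ {m} (i : Fin (suc m)) → prev (next i) ≡ i
prev-next i with view i
... | ‵fromℕ     = refl
... | ‵inject₁ j = refl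

next-inject₁ : ∀ {m} (j : Fin m) → next (inject₁ j) ≡ suc j
next-inject₁ j rewrite view-inject₁ j = refl

next-prev : ∀ {m} (i : Fin (suc m)) → next (prev i) ≡ i
next-prev {m} zero rewrite view-fromℕ m = refl
next-prev (suc j) = next-inject₁ j

next≢ : ∀ {m} (i : Fin (2 + m)) → next i ≢ i
next≢ i with view i
... | ‵fromℕ     = λ ()
... | ‵inject₁ j = λ eq → 1+n≢n (trans (cong toℕ eq) (Fin.toℕ-inject₁ j))

prev≢ : ∀ {m} (i : Fin (2 + m)) → prev i ≢ i
prev≢ i eq = next≢ i (trans (cong next (sym eq)) (next-prev i))

-- This excludes multiple edges and is the reason for rings of size `3 + m`.
next≢prev : ∀ {m} (i : Fin (3 + m)) → next i ≢ prev i
next≢prev i with view i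
... | ‵fromℕ           = λ ()
... | ‵inject₁ zero    = λ ()
... | ‵inject₁ (suc j) = λ eq → m+1+n≢n 1 (trans (cong toℕ eq)
        (trans (Fin.toℕ-inject₁ (inject₁ j)) (Fin.toℕ-inject₁ j)))

ring : ∀ m → PortGraph (3 + m)
ring m = record
  { deg              = λ _ → 2
  ; rot              = λ { (u , zero) → next u , suc zero ; (u , suc zero) → prev u , zero }
  ; rot-involutive   = λ { (u , zero)     → cong (_, zero) (prev-next u)
                         ; (u , suc zero) → cong (_, suc zero) (next-prev u) }
  ; no-loops         = λ { u zero → next≢ u ; u (suc zero) → prev≢ u }
  ; no-multiple-edge = λ { u zero zero _ → refl
                         ; u zero (suc zero) eq → contradiction eq (next≢prev u)
                         ; u (suc zero) zero eq → contradiction (sym eq) (next≢prev u)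
                         ; u (suc zero) (suc zero) _ → refl }
  -- Down from `u` to `zero` by ports 1, then up to `w` by ports 0.
  ; connected        = λ u w → <-weakInduction (λ u → Star _ u zero) ε
                                 (λ j path → (suc zero , refl) ◅ path) u
                            ◅◅ <-weakInduction (Star _ zero) ε
                                 (λ j path → path ◅◅ (zero , next-inject₁ j) ◅ ε) w
  }

ring-port : ∀ {m m′} (u : Fin (3 + m)) (u′ : Fin (3 + m′)) p →
            proj₂ (rot (ring m) (u , p)) ≡ proj₂ (rot (ring m′) (u′ , p))
ring-port u u′ zero       = refl
ring-port u u′ (suc zero) = refl

-- All nodes of all rings look the same, so the history determines the run.
ring-run-unique : ∀ {A s m m′ u u′ h ws ws′} →
                  Execution A s (ring m) u h ws → Execution A s (ring m′) u′ h ws′ →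
                  length ws ≡ length ws′
ring-run-unique (stop _) (stop _) = refl
ring-run-unique (stop a) (step a′ _ _) with () ← trans (sym a) a′
ring-run-unique (step a _ _) (stop a′) with () ← trans (sym a) a′
ring-run-unique {u = u} {u′} (step {p = p} a refl run) (step a′ refl run′)
  with refl ← just-injective (trans (sym a) a′)
  rewrite ring-port u u′ p = cong suc (ring-run-unique run run′)

-- The lower bound on the size of advice

covering⇒≤ : ∀ {n} {xs : List (Fin n)} → (∀ u → u ∈ xs) → n ≤ length xs
covering⇒≤ cover = Fin.injective⇒≤ {f = λ u → index (cover u)} λ {u} {w} →
  Membership.index-injective (setoid _) (cover u) (cover w)

-- Adding `2 ^ r` to `x` raises `n` to the power `2 ^ 2 ^ r`, which exceeds `r = suc (k + a)`: `k`
-- factors for the power, `a` for the coefficient as `a < 2 ^ a`, and one for strictness.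
tower-growth : ∀ a k {x x′} → x + 2 ^ suc (k + a) ≤ x′ →
               suc (a * (2 ^ 2 ^ x) ^ k) < 2 ^ 2 ^ x′
tower-growth a k {x} {x′} x+2^r≤x′ = begin-strict
  suc (a * n ^ k)                 ≤⟨ +-monoˡ-≤ (a * n ^ k) n^k>0 ⟩
  suc a * n ^ k                   <⟨ m<m*n (suc a * n ^ k) 2 {{>-nonZero (*-mono-≤ (s≤s (z≤n {a})) n^k>0)}} ≤-refl ⟩
  suc a * n ^ k * 2               ≤⟨ *-mono-≤ (*-monoˡ-≤ (n ^ k) (≤-trans (n<2^n a) (^-monoˡ-≤ a 2≤n))) 2≤n ⟩
  n ^ a * n ^ k * n               ≡⟨ trans (*-comm _ n) (cong (n *_) (*-comm (n ^ a) (n ^ k))) ⟩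
  n * (n ^ k * n ^ a)             ≡⟨ cong (n *_) (^-distribˡ-+-* n k a) ⟨
  n ^ r                           ≤⟨ ^-monoʳ-≤ n {{>-nonZero 0<n}} (≤-trans (<⇒≤ (n<2^n r)) (^-monoʳ-≤ 2 (<⇒≤ (n<2^n r)))) ⟩
  n ^ (2 ^ 2 ^ r)                 ≡⟨ ^-*-assoc 2 (2 ^ x) (2 ^ 2 ^ r) ⟩
  2 ^ (2 ^ x * 2 ^ 2 ^ r)         ≡⟨ cong (2 ^_) (^-distribˡ-+-* 2 x (2 ^ r)) ⟨
  2 ^ 2 ^ (x + 2 ^ r)             ≤⟨ ^-monoʳ-≤ 2 (^-monoʳ-≤ 2 x+2^r≤x′) ⟩
  2 ^ 2 ^ x′                      ∎
  where
  n = 2 ^ 2 ^ x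
  r = suc (k + a)
  0<n : 0 < n
  0<n = m^n>0 2 (2 ^ x)
  2≤n : 2 ≤ n
  2≤n = ^-monoʳ-≤ 2 (m^n>0 2 x)
  n^k>0 : 0 < n ^ k
  n^k>0 = m^n>0 n {{>-nonZero 0<n}} k

-- `value` maps the strings of length at most `ℓ` below `2 ^ suc ℓ ∸ 1`, one fewer than there are
-- indices.
short-advice-collision : ∀ {ℓ} (g : Fin (2 ^ suc ℓ) → Advice) → (∀ i → length (g i) ≤ ℓ) →
                         ∃₂ λ i j → toℕ i < toℕ j × g i ≡ g j
short-advice-collision {ℓ} g short =
  let i , j , i<j , eq = Fin.pigeonhole (≤-reflexive (suc-pred (2 ^ suc ℓ) {{m^n≢0 2 (suc ℓ)}}))
                                        (λ i → fromℕ< (value< i))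
  in  i , j , i<j , value-injective _ _ (Fin.fromℕ<-injective _ _ (value< i) (value< j) eq)
  where
  value< : ∀ i → value (g i) < pred (2 ^ suc ℓ)
  value< i = pred-mono-< (<-≤-trans (value-upper (g i)) (^-monoʳ-≤ 2 (s≤s (short i))))

-- Once φ exceeds r, the 2^(N+1) rings of sizes 2^2^x, where x = 2^y + i 2^r lies
-- below 2^(y+1), get advice of length at most y - (r + 1) = N; fewer than
-- 2^(N+1) strings are that short.
no-small-advice : ∀ φ → TendsToInfinity φ → (f : InstanceOracle) (A : Algorithm) →
                  AdviceSizeAtMost f (λ n → logloglog n - φ n) → ¬ ExploresInPolyTime A f
no-small-advice φ φ→∞ f A small (a , k , explores) = no-collision (short-advice-collision advice advice-length)
  where
  r = suc (k + a)
  -- `N` is both the size from which `φ` exceeds `r` and the resulting bound on the advice length.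
  N = proj₁ (φ→∞ (suc r))
  -- Now `#rings * 2 ^ r` equals `2 ^ y`, so every `x i` has logarithm `y` and successive ones are
  -- `2 ^ r` apart.
  y = suc N + r
  #rings = 2 ^ suc N

  x : Fin #rings → ℕ
  x i = 2 ^ y + toℕ i * 2 ^ r

  x-upper : ∀ i → x i < 2 ^ suc y
  x-upper i = begin-strict
    2 ^ y + toℕ i * 2 ^ r  <⟨ +-monoʳ-< (2 ^ y) (*-monoˡ-< (2 ^ r) {{m^n≢0 2 r}} (Fin.toℕ<n i)) ⟩
    2 ^ y + #rings * 2 ^ r ≡⟨ cong (2 ^ y +_) (^-distribˡ-+-* 2 (suc N) r) ⟨
    2 ^ y + 2 ^ y          ≡⟨ cong (2 ^ y +_) (+-identityʳ (2 ^ y)) ⟨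
    2 ^ suc y              ∎

  x-gap : ∀ i j → toℕ i < toℕ j → x i + 2 ^ r ≤ x j
  x-gap i j i<j = begin
    2 ^ y + toℕ i * 2 ^ r + 2 ^ r    ≡⟨ +-assoc (2 ^ y) _ _ ⟩
    2 ^ y + (toℕ i * 2 ^ r + 2 ^ r)  ≡⟨ cong (2 ^ y +_) (+-comm _ (2 ^ r)) ⟩
    2 ^ y + suc (toℕ i) * 2 ^ r      ≤⟨ +-monoʳ-≤ (2 ^ y) (*-monoˡ-≤ (2 ^ r) i<j) ⟩
    x j                              ∎

  m : Fin #rings → ℕ
  m i = 2 ^ 2 ^ x i ∸ 3

  y≤x : ∀ i → y < x i
  y≤x i = ≤-trans (n<2^n y) (m≤m+n _ _)

  size : ∀ i → 3 + m i ≡ 2 ^ 2 ^ x i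
  -- Subtracting 3 does not truncate: `x i` is positive, so the tower is at least 4.
  size i = m+[n∸m]≡n (<⇒≤ (^-monoʳ-≤ 2 {2} (^-monoʳ-≤ 2 {1} (≤-trans (s≤s z≤n) (y≤x i)))))

  advice : Fin #rings → Advice
  advice i = f (ring (m i)) zero

  N≤size : ∀ i → N ≤ 3 + m i
  N≤size i = begin
    N              ≤⟨ m≤n+m N 1 ⟩
    suc N          ≤⟨ m≤m+n (suc N) r ⟩
    y              ≤⟨ <⇒≤ (y≤x i) ⟩
    x i            ≤⟨ <⇒≤ (n<2^n (x i)) ⟩
    2 ^ x i        ≤⟨ <⇒≤ (n<2^n (2 ^ x i)) ⟩
    2 ^ 2 ^ x i    ≡⟨ size i ⟨
    3 + m i        ∎

  advice-length : ∀ i → length (advice i) ≤ N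
  advice-length i = begin
    length (advice i)                                      ≤⟨ small (ring (m i)) zero ⟩
    ⌊log₂ ⌊log₂ ⌊log₂ 3 + m i ⌋ ⌋ ⌋ ∸ φ (3 + m i)          ≡⟨ cong (λ n → ⌊log₂ ⌊log₂ ⌊log₂ n ⌋ ⌋ ⌋ ∸ φ (3 + m i)) (size i) ⟩
    ⌊log₂ ⌊log₂ ⌊log₂ 2 ^ 2 ^ x i ⌋ ⌋ ⌋ ∸ φ (3 + m i)      ≡⟨ cong (λ n → ⌊log₂ ⌊log₂ n ⌋ ⌋ ∸ φ (3 + m i)) (⌊log₂[2^n]⌋≡n (2 ^ x i)) ⟩
    ⌊log₂ ⌊log₂ 2 ^ x i ⌋ ⌋ ∸ φ (3 + m i)                  ≡⟨ cong (λ n → ⌊log₂ n ⌋ ∸ φ (3 + m i)) (⌊log₂[2^n]⌋≡n (x i)) ⟩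
    ⌊log₂ x i ⌋ ∸ φ (3 + m i)                              ≤⟨ ∸-mono (<2^⇒⌊log₂⌋≤ y (x-upper i)) (proj₂ (φ→∞ (suc r)) _ (N≤size i)) ⟩
    y ∸ suc r                                              ≡⟨ m+n∸n≡m N r ⟩
    N                                                      ∎

  -- With equal advice the larger ring is left after as many steps as the smaller one, too few to
  -- visit all its nodes.
  no-collision : ¬ (∃₂ λ i j → toℕ i < toℕ j × advice i ≡ advice j)
  no-collision (i , j , i<j , same)
    with ws , run , _ , short ← explores (ring (m i)) zero
       | ws′ , run′ , cover , _ ← explores (ring (m j)) zero = <-irrefl refl (begin-strict
    3 + m j                              ≤⟨ covering⇒≤ cover ⟩
    suc (length ws′)                     ≡⟨ cong suc (ring-run-unique run (subst (λ s → Execution A s _ _ _ _) (sym same) run′)) ⟨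
    suc (length ws)                      ≤⟨ s≤s short ⟩
    suc (a * (3 + m i) ^ k)              ≡⟨ cong (λ n → suc (a * n ^ k)) (size i) ⟩
    suc (a * (2 ^ 2 ^ x i) ^ k)          <⟨ tower-growth a k {x i} {x j} (x-gap i j i<j) ⟩
    2 ^ 2 ^ x j                          ≡⟨ size j ⟨
    3 + m j                              ∎)

mainTheorem3 : ((c : ℕ) → 0 < c →
    Σ[ f ∈ MapOracle ] Σ[ A ∈ Algorithm ]
    (LabelIndependent f
    × AdviceSizeAtMost (toInstance f) (λ n → logloglog n - c)
    × ExploresInPolyTime A (toInstance f)))
    ×
    ((φ : ℕ → ℕ) → TendsToInfinity φ →
    ¬ (Σ[ f ∈ InstanceOracle ] Σ[ A ∈ Algorithm ]
    (AdviceSizeAtMost f (λ n → logloglog n - φ n)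
    × ExploresInPolyTime A f))
    × ¬ (Σ[ f ∈ MapOracle ] Σ[ A ∈ Algorithm ]
    (AdviceSizeAtMost (toInstance f) (λ n → logloglog n - φ n)
    × ExploresInPolyTime A (toInstance f))))
mainTheorem3 =
  -- The advice depends on the number of nodes alone, so label independence is `refl`.
  (λ c _ → oracle c , explorer c , (λ _ _ _ → refl) ,
           (λ {n} _ _ → length-encode-loglogQuotient c n) , explorer-explores c) ,
  λ φ φ→∞ → (λ (f , A , small , explores) → no-small-advice φ φ→∞ f A small explores) ,
            (λ (f , A , small , explores) → no-small-advice φ φ→∞ (toInstance f) A small explores)
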